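{- Let $B$ be an $A$-algebra which is an integral domain, and let $f:A\to B$ be an additive group homomorphism. Then for every positive integer $d$ and every $c\in A(d)$, $$M_d(f)(z+c)-M_d(f)(z)=M_d(1)\,f(c)\quad\text{in } B[z].$$
   Context: $q$ is a power of a prime, $A=\mathbb{F}_q[\theta]$, $A_+(d)$ is the set of monic polynomials in $A$ of degree $d$, and for $d\ge1$, $A(d)$ is the $\mathbb{F}_q$-vector space of polynomials in $A$ of degree $<d$. For a function $f:A\to B$ and $d\ge0$, the Carlitz approximation is $M_d(f)(z):=\sum_{b\in A_+(d)} f(b)\prod_{a\in A_+(d)\setminus\{b\}}(z-a)\in B[z]$. $M_d(1)$ denotes $M_d$ applied to the constant function $1$; it is a constant (equal to the image of $(-1)^dD_d/L_d$, where $D_d$ is the product of all monic polynomials of degree $d$ and $L_d$ the least common multiple of all polynomials of degree $d$). -}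

module Defs where

open import Algebra.Bundles using (CommutativeRing; RawRing)
open import Algebra.Morphism.Structures using (module RingMorphisms; module GroupMorphisms)
import Algebra.Properties.AbelianGroup as AbelianGroupProperties
import Algebra.Properties.CommutativeSemigroup as CommutativeSemigroupProperties
open import Data.Empty using (⊥-elim)
open import Data.Fin.Base using (Fin)
import Data.Fin.Properties as Fin
open import Data.List.Base using (List; []; _∷_; [_]; map; foldr; filter; tabulate; cartesianProductWith)
import Data.List.Membership.Setoid as Membership
import Data.List.Membership.Setoid.Properties as Membershipₚ
import Data.List.Relation.Unary.AllPairs as AllPairs
import Data.List.Relation.Unary.All as All
open import Data.List.Relation.Unary.Any using (here)
open import Data.List.Relation.Unary.Unique.Setoid using (Unique)
import Data.List.Relation.Unary.Unique.Setoid.Properties as Uniqueₚ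
open import Data.Nat.Base as ℕ using (ℕ; zero; suc; z≤n; s≤s)
open import Data.Nat.Primality using (Prime)
open import Data.Product.Base using (∃; ∃₂; _×_; _,_)
open import Data.Sum.Base using (_⊎_)
open import Function.Bundles using (Inverse)
open import Level using (Level; _⊔_) renaming (suc to lsuc)
open import Relation.Binary.Bundles using (Setoid)
open import Relation.Binary.Definitions using (Decidable)
open import Relation.Binary.PropositionalEquality as ≡ using (_≡_)
import Relation.Binary.Reasoning.Setoid as SetoidReasoning
open import Relation.Nullary using (¬_; yes)
open import Relation.Nullary.Decidable using (¬?)
import Relation.Nullary.Decidable as Dec

IsPrimePower : ℕ → Set
IsPrimePower q = ∃₂ λ p k → Prime p × 1 ℕ.≤ k × q ≡ p ℕ.^ k

record IsField {c ℓ} (R : CommutativeRing c ℓ) : Set (c ⊔ ℓ) where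
  open CommutativeRing R
  field
    1≉0     : ¬ (1# ≈ 0#)
    inverse : ∀ x → ¬ (x ≈ 0#) → ∃ λ y → x * y ≈ 1#

record IsIntegralDomain {c ℓ} (R : CommutativeRing c ℓ) : Set (c ⊔ ℓ) where
  open CommutativeRing R
  field
    1≉0            : ¬ (1# ≈ 0#)
    noZeroDivisors : ∀ x y → x * y ≈ 0# → x ≈ 0# ⊎ y ≈ 0#

record FiniteField (c ℓ : Level) (q : ℕ) : Set (lsuc (c ⊔ ℓ)) where
  field
    commutativeRing : CommutativeRing c ℓ
    isField         : IsField commutativeRing
    enumeration     : Inverse (≡.setoid (Fin q)) (CommutativeRing.setoid commutativeRing)

record CommutativeAlgebra {c ℓ} (A : CommutativeRing c ℓ) (b ℓᵇ : Level) : Set (c ⊔ ℓ ⊔ lsuc (b ⊔ ℓᵇ)) where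
  private module A = CommutativeRing A
  field
    commutativeRing : CommutativeRing b ℓᵇ
  open CommutativeRing commutativeRing public
  field
    ι                    : A.Carrier → Carrier
    ι-isRingHomomorphism : RingMorphisms.IsRingHomomorphism A.rawRing rawRing ι

IsAdditive : ∀ {a ℓᵃ b ℓᵇ} (A : CommutativeRing a ℓᵃ) (B : CommutativeRing b ℓᵇ) →
             (CommutativeRing.Carrier A → CommutativeRing.Carrier B) → Set (a ⊔ ℓᵃ ⊔ ℓᵇ)
IsAdditive A B = GroupMorphisms.IsGroupHomomorphism (+-group A) (+-group B)
  where
  +-group : ∀ {c ℓ} (R : CommutativeRing c ℓ) → _
  +-group R = RawRing.+-rawGroup (CommutativeRing.rawRing R)

-- Univariate polynomials over R as coefficient lists, constant term first.
-- Trailing zeros are allowed; _≋_ identifies lists that differ only by them.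
module Polynomial {c ℓ} (R : CommutativeRing c ℓ) where

  open CommutativeRing R
  open AbelianGroupProperties +-abelianGroup using () renaming (ε⁻¹≈ε to -0≈0)
  open CommutativeSemigroupProperties +-commutativeSemigroup using (interchange)

  Poly : Set c
  Poly = List Carrier

  coeff : Poly → ℕ → Carrier
  coeff []      n       = 0#
  coeff (a ∷ p) zero    = a
  coeff (a ∷ p) (suc n) = coeff p n

  infix 4 _≋_
  record _≋_ (p q : Poly) : Set ℓ where
    constructor coeffwise
    field at : ∀ n → coeff p n ≈ coeff q n
  open _≋_ public

  infixl 6 _+ₚ_
  infixl 7 _*ₚ_ _·_
  infix  8 -ₚ_
  infixr 9 _∘ₚ_

  _+ₚ_ : Poly → Poly → Poly
  []      +ₚ q       = q
  (a ∷ p) +ₚ []      = a ∷ p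
  (a ∷ p) +ₚ (b ∷ q) = (a + b) ∷ (p +ₚ q)

  -ₚ_ : Poly → Poly
  -ₚ_ = map (-_)

  _·_ : Carrier → Poly → Poly
  a · p = map (a *_) p

  _*ₚ_ : Poly → Poly → Poly
  []      *ₚ q = []
  (a ∷ p) *ₚ q = a · q +ₚ (0# ∷ (p *ₚ q))

  const : Carrier → Poly
  const a = [ a ]

  X : Poly
  X = 0# ∷ 1# ∷ []

  -- p ∘ₚ g is p(g), by Horner's rule.
  _∘ₚ_ : Poly → Poly → Poly
  p ∘ₚ g = foldr (λ a r → const a +ₚ g *ₚ r) [] p

  HasDegree<_ : ℕ → Poly → Set ℓ
  HasDegree< d = λ p → ∀ n → d ℕ.≤ n → coeff p n ≈ 0#

  IsMonicOfDegree : ℕ → Poly → Set ℓ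
  IsMonicOfDegree d p = coeff p d ≈ 1# × (∀ n → d ℕ.< n → coeff p n ≈ 0#)

  coeff-+ : ∀ p q n → coeff (p +ₚ q) n ≈ coeff p n + coeff q n
  coeff-+ []      q       n       = sym (+-identityˡ _)
  coeff-+ (a ∷ p) []      n       = sym (+-identityʳ _)
  coeff-+ (a ∷ p) (b ∷ q) zero    = refl
  coeff-+ (a ∷ p) (b ∷ q) (suc n) = coeff-+ p q n

  coeff-neg : ∀ p n → coeff (-ₚ p) n ≈ - coeff p n
  coeff-neg []      n       = sym -0≈0
  coeff-neg (a ∷ p) zero    = refl
  coeff-neg (a ∷ p) (suc n) = coeff-neg p n

  coeff-· : ∀ a p n → coeff (a · p) n ≈ a * coeff p n
  coeff-· a []      n       = sym (zeroʳ a)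
  coeff-· a (b ∷ p) zero    = refl
  coeff-· a (b ∷ p) (suc n) = coeff-· a p n

  ≋-refl : ∀ {p} → p ≋ p
  ≋-refl = coeffwise λ _ → refl

  ≋-sym : ∀ {p q} → p ≋ q → q ≋ p
  ≋-sym e = coeffwise λ n → sym (at e n)

  ≋-trans : ∀ {p q r} → p ≋ q → q ≋ r → p ≋ r
  ≋-trans e f = coeffwise λ n → trans (at e n) (at f n)

  ≋-setoid : Setoid c ℓ
  ≋-setoid = record
    { Carrier = Poly ; _≈_ = _≋_
    ; isEquivalence = record { refl = ≋-refl ; sym = ≋-sym ; trans = ≋-trans } }

  ∷-cong : ∀ {a b p q} → a ≈ b → p ≋ q → (a ∷ p) ≋ (b ∷ q)
  ∷-cong e f = coeffwise λ { zero → e ; (suc n) → at f n }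

  ∷-injective : ∀ {a b p q} → (a ∷ p) ≋ (b ∷ q) → a ≈ b × p ≋ q
  ∷-injective e = at e 0 , coeffwise λ n → at e (suc n)

  +ₚ-cong : ∀ {p p′ q q′} → p ≋ p′ → q ≋ q′ → p +ₚ q ≋ p′ +ₚ q′
  +ₚ-cong {p} {p′} {q} {q′} e f = coeffwise λ n →
    trans (coeff-+ p q n) (trans (+-cong (at e n) (at f n)) (sym (coeff-+ p′ q′ n)))

  -ₚ-cong : ∀ {p q} → p ≋ q → -ₚ p ≋ -ₚ q
  -ₚ-cong {p} {q} e = coeffwise λ n →
    trans (coeff-neg p n) (trans (-‿cong (at e n)) (sym (coeff-neg q n)))

  ·-cong : ∀ {a b p q} → a ≈ b → p ≋ q → a · p ≋ b · q
  ·-cong {a} {b} {p} {q} e f = coeffwise λ n →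
    trans (coeff-· a p n) (trans (*-cong e (at f n)) (sym (coeff-· b q n)))

  +ₚ-assoc : ∀ p q r → (p +ₚ q) +ₚ r ≋ p +ₚ (q +ₚ r)
  +ₚ-assoc p q r = coeffwise λ n → begin
    coeff ((p +ₚ q) +ₚ r) n               ≈⟨ coeff-+ (p +ₚ q) r n ⟩
    coeff (p +ₚ q) n + coeff r n          ≈⟨ +-congʳ (coeff-+ p q n) ⟩
    coeff p n + coeff q n + coeff r n     ≈⟨ +-assoc _ _ _ ⟩
    coeff p n + (coeff q n + coeff r n)   ≈⟨ +-congˡ (coeff-+ q r n) ⟨
    coeff p n + coeff (q +ₚ r) n          ≈⟨ coeff-+ p (q +ₚ r) n ⟨
    coeff (p +ₚ (q +ₚ r)) n               ∎
    where open SetoidReasoning setoid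

  +ₚ-comm : ∀ p q → p +ₚ q ≋ q +ₚ p
  +ₚ-comm p q = coeffwise λ n →
    trans (coeff-+ p q n) (trans (+-comm _ _) (sym (coeff-+ q p n)))

  +ₚ-identityʳ : ∀ p → p +ₚ [] ≋ p
  +ₚ-identityʳ p = coeffwise λ n → trans (coeff-+ p [] n) (+-identityʳ _)

  -ₚ-inverseʳ : ∀ p → p +ₚ -ₚ p ≋ []
  -ₚ-inverseʳ p = coeffwise λ n →
    trans (coeff-+ p (-ₚ p) n) (trans (+-congˡ (coeff-neg p n)) (-‿inverseʳ _))

  -ₚ-inverseˡ : ∀ p → -ₚ p +ₚ p ≋ []
  -ₚ-inverseˡ p = ≋-trans (+ₚ-comm (-ₚ p) p) (-ₚ-inverseʳ p)

  +ₚ-interchange : ∀ p q r s → (p +ₚ q) +ₚ (r +ₚ s) ≋ (p +ₚ r) +ₚ (q +ₚ s)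
  +ₚ-interchange p q r s = coeffwise λ n →
    trans (split p q r s n) (trans (interchange _ _ _ _) (sym (split p r q s n)))
    where
    split : ∀ p q r s n → coeff ((p +ₚ q) +ₚ (r +ₚ s)) n ≈ (coeff p n + coeff q n) + (coeff r n + coeff s n)
    split p q r s n = trans (coeff-+ (p +ₚ q) (r +ₚ s) n) (+-cong (coeff-+ p q n) (coeff-+ r s n))

  ·-distribˡ : ∀ a p q → a · (p +ₚ q) ≋ a · p +ₚ a · q
  ·-distribˡ a p q = coeffwise λ n → begin
    coeff (a · (p +ₚ q)) n              ≈⟨ coeff-· a (p +ₚ q) n ⟩
    a * coeff (p +ₚ q) n                ≈⟨ *-congˡ (coeff-+ p q n) ⟩
    a * (coeff p n + coeff q n)         ≈⟨ distribˡ a _ _ ⟩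
    a * coeff p n + a * coeff q n       ≈⟨ +-cong (coeff-· a p n) (coeff-· a q n) ⟨
    coeff (a · p) n + coeff (a · q) n   ≈⟨ coeff-+ (a · p) (a · q) n ⟨
    coeff (a · p +ₚ a · q) n            ∎
    where open SetoidReasoning setoid

  ·-distribʳ : ∀ a b p → (a + b) · p ≋ a · p +ₚ b · p
  ·-distribʳ a b p = coeffwise λ n → begin
    coeff ((a + b) · p) n               ≈⟨ coeff-· (a + b) p n ⟩
    (a + b) * coeff p n                 ≈⟨ distribʳ _ a b ⟩
    a * coeff p n + b * coeff p n       ≈⟨ +-cong (coeff-· a p n) (coeff-· b p n) ⟨
    coeff (a · p) n + coeff (b · p) n   ≈⟨ coeff-+ (a · p) (b · p) n ⟨
    coeff (a · p +ₚ b · p) n            ∎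
    where open SetoidReasoning setoid

  ·-assoc : ∀ a b p → (a * b) · p ≋ a · (b · p)
  ·-assoc a b p = coeffwise λ n → begin
    coeff ((a * b) · p) n   ≈⟨ coeff-· (a * b) p n ⟩
    a * b * coeff p n       ≈⟨ *-assoc a b _ ⟩
    a * (b * coeff p n)     ≈⟨ *-congˡ (coeff-· b p n) ⟨
    a * coeff (b · p) n     ≈⟨ coeff-· a (b · p) n ⟨
    coeff (a · (b · p)) n   ∎
    where open SetoidReasoning setoid

  0·-zero : ∀ p → 0# · p ≋ []
  0·-zero p = coeffwise λ n → trans (coeff-· 0# p n) (zeroˡ _)

  1·-identity : ∀ p → 1# · p ≋ p
  1·-identity p = coeffwise λ n → trans (coeff-· 1# p n) (*-identityˡ _)

  0∷[]≋[] : (0# ∷ []) ≋ []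
  0∷[]≋[] = coeffwise λ { zero → refl ; (suc n) → refl }

  0∷-+ : ∀ p q → (0# ∷ (p +ₚ q)) ≋ (0# ∷ p) +ₚ (0# ∷ q)
  0∷-+ p q = ∷-cong (sym (+-identityˡ 0#)) ≋-refl

  *ₚ-congˡ : ∀ p {q r} → q ≋ r → p *ₚ q ≋ p *ₚ r
  *ₚ-congˡ []      e = ≋-refl
  *ₚ-congˡ (a ∷ p) e = +ₚ-cong (·-cong refl e) (∷-cong refl (*ₚ-congˡ p e))

  *ₚ-zeroʳ : ∀ p → p *ₚ [] ≋ []
  *ₚ-zeroʳ []      = ≋-refl
  *ₚ-zeroʳ (a ∷ p) = ≋-trans (∷-cong refl (*ₚ-zeroʳ p)) 0∷[]≋[]

  *ₚ-∷ : ∀ p b q → p *ₚ (b ∷ q) ≋ b · p +ₚ (0# ∷ (p *ₚ q))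
  *ₚ-∷ []      b q = ≋-sym 0∷[]≋[]
  *ₚ-∷ (a ∷ p) b q = ∷-cong (+-congʳ (*-comm a b)) (begin
    a · q +ₚ p *ₚ (b ∷ q)                      ≈⟨ +ₚ-cong ≋-refl (*ₚ-∷ p b q) ⟩
    a · q +ₚ (b · p +ₚ (0# ∷ (p *ₚ q)))        ≈⟨ +ₚ-assoc (a · q) (b · p) _ ⟨
    (a · q +ₚ b · p) +ₚ (0# ∷ (p *ₚ q))        ≈⟨ +ₚ-cong (+ₚ-comm (a · q) (b · p)) ≋-refl ⟩
    (b · p +ₚ a · q) +ₚ (0# ∷ (p *ₚ q))        ≈⟨ +ₚ-assoc (b · p) (a · q) _ ⟩
    b · p +ₚ (a · q +ₚ (0# ∷ (p *ₚ q)))        ∎)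
    where open SetoidReasoning ≋-setoid

  *ₚ-comm : ∀ p q → p *ₚ q ≋ q *ₚ p
  *ₚ-comm []      q = ≋-sym (*ₚ-zeroʳ q)
  *ₚ-comm (a ∷ p) q = ≋-trans (+ₚ-cong ≋-refl (∷-cong refl (*ₚ-comm p q))) (≋-sym (*ₚ-∷ q a p))

  *ₚ-cong : ∀ {p p′ q q′} → p ≋ p′ → q ≋ q′ → p *ₚ q ≋ p′ *ₚ q′
  *ₚ-cong {p} {p′} {q} {q′} e f = begin
    p *ₚ q     ≈⟨ *ₚ-congˡ p f ⟩
    p *ₚ q′    ≈⟨ *ₚ-comm p q′ ⟩
    q′ *ₚ p    ≈⟨ *ₚ-congˡ q′ e ⟩
    q′ *ₚ p′   ≈⟨ *ₚ-comm q′ p′ ⟩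
    p′ *ₚ q′   ∎
    where open SetoidReasoning ≋-setoid

  *ₚ-distribˡ : ∀ p q r → p *ₚ (q +ₚ r) ≋ p *ₚ q +ₚ p *ₚ r
  *ₚ-distribˡ []      q r = ≋-refl
  *ₚ-distribˡ (a ∷ p) q r = begin
    a · (q +ₚ r) +ₚ (0# ∷ (p *ₚ (q +ₚ r)))
      ≈⟨ +ₚ-cong (·-distribˡ a q r) (∷-cong refl (*ₚ-distribˡ p q r)) ⟩
    (a · q +ₚ a · r) +ₚ (0# ∷ (p *ₚ q +ₚ p *ₚ r))
      ≈⟨ +ₚ-cong ≋-refl (0∷-+ (p *ₚ q) (p *ₚ r)) ⟩
    (a · q +ₚ a · r) +ₚ ((0# ∷ (p *ₚ q)) +ₚ (0# ∷ (p *ₚ r)))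
      ≈⟨ +ₚ-interchange (a · q) (a · r) _ _ ⟩
    (a ∷ p) *ₚ q +ₚ (a ∷ p) *ₚ r ∎
    where open SetoidReasoning ≋-setoid

  *ₚ-distribʳ : ∀ r p q → (p +ₚ q) *ₚ r ≋ p *ₚ r +ₚ q *ₚ r
  *ₚ-distribʳ r p q = begin
    (p +ₚ q) *ₚ r      ≈⟨ *ₚ-comm (p +ₚ q) r ⟩
    r *ₚ (p +ₚ q)      ≈⟨ *ₚ-distribˡ r p q ⟩
    r *ₚ p +ₚ r *ₚ q   ≈⟨ +ₚ-cong (*ₚ-comm r p) (*ₚ-comm r q) ⟩
    p *ₚ r +ₚ q *ₚ r   ∎
    where open SetoidReasoning ≋-setoid

  ·-*ₚ-assoc : ∀ a p q → (a · p) *ₚ q ≋ a · (p *ₚ q)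
  ·-*ₚ-assoc a []      q = ≋-refl
  ·-*ₚ-assoc a (b ∷ p) q = begin
    (a * b) · q +ₚ (0# ∷ ((a · p) *ₚ q))
      ≈⟨ +ₚ-cong (·-assoc a b q) (∷-cong (sym (zeroʳ a)) (·-*ₚ-assoc a p q)) ⟩
    a · (b · q) +ₚ a · (0# ∷ (p *ₚ q))
      ≈⟨ ·-distribˡ a (b · q) (0# ∷ (p *ₚ q)) ⟨
    a · ((b ∷ p) *ₚ q) ∎
    where open SetoidReasoning ≋-setoid

  *ₚ-assoc : ∀ p q r → (p *ₚ q) *ₚ r ≋ p *ₚ (q *ₚ r)
  *ₚ-assoc []      q r = ≋-refl
  *ₚ-assoc (a ∷ p) q r = begin
    (a · q +ₚ (0# ∷ (p *ₚ q))) *ₚ r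
      ≈⟨ *ₚ-distribʳ r (a · q) (0# ∷ (p *ₚ q)) ⟩
    (a · q) *ₚ r +ₚ (0# · r +ₚ (0# ∷ ((p *ₚ q) *ₚ r)))
      ≈⟨ +ₚ-cong (·-*ₚ-assoc a q r) (+ₚ-cong (0·-zero r) (∷-cong refl (*ₚ-assoc p q r))) ⟩
    (a ∷ p) *ₚ (q *ₚ r) ∎
    where open SetoidReasoning ≋-setoid

  *ₚ-identityˡ : ∀ p → const 1# *ₚ p ≋ p
  *ₚ-identityˡ p = ≋-trans (+ₚ-cong (1·-identity p) 0∷[]≋[]) (+ₚ-identityʳ p)

  *ₚ-identityʳ : ∀ p → p *ₚ const 1# ≋ p
  *ₚ-identityʳ p = ≋-trans (*ₚ-comm p (const 1#)) (*ₚ-identityˡ p)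

  polynomialRing : CommutativeRing c ℓ
  polynomialRing = record
    { Carrier = Poly ; _≈_ = _≋_ ; _+_ = _+ₚ_ ; _*_ = _*ₚ_ ; -_ = -ₚ_ ; 0# = [] ; 1# = const 1#
    ; isCommutativeRing = record
      { isRing = record
        { +-isAbelianGroup = record
          { isGroup = record
            { isMonoid = record
              { isSemigroup = record
                { isMagma = record { isEquivalence = Setoid.isEquivalence ≋-setoid ; ∙-cong = +ₚ-cong }
                ; assoc = +ₚ-assoc }
              ; identity = (λ p → ≋-refl) , +ₚ-identityʳ }
            ; inverse = -ₚ-inverseˡ , -ₚ-inverseʳ
            ; ⁻¹-cong = -ₚ-cong }
          ; comm = +ₚ-comm }
        ; *-cong = *ₚ-cong
        ; *-assoc = *ₚ-assoc
        ; *-identity = *ₚ-identityˡ , *ₚ-identityʳ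
        ; distrib = *ₚ-distribˡ , *ₚ-distribʳ }
      ; *-comm = *ₚ-comm } }

  module _ (_≟_ : Decidable _≈_) where

    ≋-dec : Decidable _≋_
    ≋-dec []      []      = yes ≋-refl
    ≋-dec []      (b ∷ q) = Dec.map′
      (λ { (e , f) → coeffwise λ { zero → e ; (suc n) → at f n } })
      (λ e → at e 0 , coeffwise λ n → at e (suc n))
      ((0# ≟ b) Dec.×-dec ≋-dec [] q)
    ≋-dec (a ∷ p) []      = Dec.map′
      (λ { (e , f) → coeffwise λ { zero → e ; (suc n) → at f n } })
      (λ e → at e 0 , coeffwise λ n → at e (suc n))
      ((a ≟ 0#) Dec.×-dec ≋-dec p [])
    ≋-dec (a ∷ p) (b ∷ q) = Dec.map′
      (λ { (e , f) → ∷-cong e f }) ∷-injective ((a ≟ b) Dec.×-dec ≋-dec p q)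

module FiniteFieldPolynomials {c ℓ q} (𝔽 : FiniteField c ℓ q) where

  open FiniteField 𝔽
  open CommutativeRing commutativeRing
  open Polynomial commutativeRing
  open Inverse enumeration using (to; from; to-cong; from-cong; strictlyInverseˡ; strictlyInverseʳ)

  A : CommutativeRing c ℓ
  A = polynomialRing

  A[_] : ℕ → Poly → Set ℓ
  A[ d ] = HasDegree< d

  _≟_ : Decidable _≈_
  x ≟ y = Dec.map′
    (λ e → trans (sym (strictlyInverseˡ x)) (trans (to-cong e) (strictlyInverseˡ y)))
    from-cong
    (from x Fin.≟ from y)

  _≟ₚ_ : Decidable _≋_
  _≟ₚ_ = ≋-dec _≟_

  elements : List Carrier
  elements = tabulate to

  -- Enumerates A₊(d); see A₊-sound, A₊-complete and A₊-unique.
  A₊ : ℕ → List Poly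
  A₊ zero    = [ const 1# ]
  A₊ (suc d) = cartesianProductWith _∷_ elements (A₊ d)

  A₊_∖_ : ℕ → Poly → List Poly
  A₊ d ∖ b = filter (λ a → ¬? (a ≟ₚ b)) (A₊ d)

  open Membership setoid using () renaming (_∈_ to _∈ᶠ_)
  open Membership ≋-setoid using (_∈_)

  elements-complete : ∀ x → x ∈ᶠ elements
  elements-complete x = Membershipₚ.∈-resp-≈ setoid (strictlyInverseˡ x) (Membershipₚ.∈-tabulate⁺ setoid (from x))

  elements-unique : Unique setoid elements
  elements-unique = Uniqueₚ.tabulate⁺ setoid λ {i} {j} e →
    ≡.trans (≡.sym (strictlyInverseʳ i)) (≡.trans (from-cong e) (strictlyInverseʳ j))

  A₊-sound : ∀ d {p} → p ∈ A₊ d → IsMonicOfDegree d p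
  A₊-sound zero    (here e) = at e 0 , λ { (suc n) _ → at e (suc n) }
  A₊-sound (suc d) p∈ =
    let a , p′ , _ , p′∈ , e = Membershipₚ.∈-cartesianProductWith⁻ setoid ≋-setoid ≋-setoid _∷_ elements (A₊ d) p∈
        lead , high          = A₊-sound d p′∈
    in trans (at e (suc d)) lead , λ { (suc n) (s≤s d<n) → trans (at e (suc n)) (high n d<n) }

  A₊-complete : ∀ d {p} → IsMonicOfDegree d p → p ∈ A₊ d
  A₊-complete zero    (lead , high) = here (coeffwise λ { zero → lead ; (suc n) → high (suc n) (s≤s z≤n) })
  A₊-complete (suc d) {[]} (lead , high) = ⊥-elim (IsField.1≉0 isField (sym lead))
  A₊-complete (suc d) {a ∷ p} (lead , high) =
    Membershipₚ.∈-cartesianProductWith⁺ setoid ≋-setoid ≋-setoid ∷-cong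
      (elements-complete a) (A₊-complete d (lead , λ n d<n → high (suc n) (s≤s d<n)))

  A₊-unique : ∀ d → Unique ≋-setoid (A₊ d)
  A₊-unique zero    = All.[] AllPairs.∷ AllPairs.[]
  A₊-unique (suc d) = Uniqueₚ.cartesianProductWith⁺ setoid ≋-setoid ≋-setoid _∷_ ∷-injective
    elements-unique (A₊-unique d)

module Carlitz {c ℓ q} (𝔽 : FiniteField c ℓ q) {b ℓᵇ}
               (B : CommutativeAlgebra (FiniteFieldPolynomials.A 𝔽) b ℓᵇ) where

  open FiniteFieldPolynomials 𝔽 using (A; A₊; A₊_∖_)
  private
    module A = CommutativeRing A
    module B = CommutativeAlgebra B
  open Polynomial B.commutativeRing using (polynomialRing)
  open Polynomial B.commutativeRing public using (const; X; _∘ₚ_)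

  B[z] : CommutativeRing b ℓᵇ
  B[z] = polynomialRing

  open CommutativeRing B[z] using (Carrier; 0#; 1#)
  open CommutativeRing B[z] public using (_≈_; _+_; _-_; _*_)

  ∑ ∏ : List A.Carrier → (A.Carrier → Carrier) → Carrier
  ∑ as g = foldr (λ a r → g a + r) 0# as
  ∏ as g = foldr (λ a r → g a * r) 1# as

  M : ℕ → (A.Carrier → B.Carrier) → Carrier
  M d f = ∑ (A₊ d) λ b → const (f b) * ∏ (A₊ d ∖ b) λ a → X - const (B.ι a)

{-# OPTIONS --safe #-}
-- Translation by c ∈ A(d) permutes A₊(d), so substituting z + c in M_d(f) and reindexing
-- b ↦ b + c, a ↦ a + c turns f(b) into f(b + c) = f(b) + f(c) and leaves every product
-- ∏_{a ≠ b} (z - a) unchanged; the extra term is f(c) times the sum of these products, M_d(1).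
module Submission where

open import Defs
open import Algebra.Bundles using (CommutativeMonoid; CommutativeRing)
open import Algebra.Morphism.Structures using (module GroupMorphisms; module RingMorphisms)
import Algebra.Properties.AbelianGroup as AbelianGroupProperties
import Algebra.Properties.CommutativeSemigroup as CommutativeSemigroupProperties
open import Data.List.Base using (List; []; _∷_; _++_; map; foldr)
import Data.List.Membership.Setoid as Membership
import Data.List.Membership.Setoid.Properties as Membershipₚ
open import Data.List.Properties using (filter-≐; foldr-map)
import Data.List.Relation.Binary.Permutation.Setoid as Permutation
import Data.List.Relation.Binary.Permutation.Setoid.Properties as Permutationₚ
open import Data.List.Relation.Unary.All.Properties using (All¬⇒¬Any)
open import Data.List.Relation.Unary.AllPairs using ([]; _∷_)
open import Data.List.Relation.Unary.Any using (here; there)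
open import Data.List.Relation.Unary.Unique.Setoid using (Unique)
import Data.List.Relation.Unary.Unique.Setoid.Properties as Uniqueₚ
open import Data.Nat.Base using (ℕ; _≤_)
open import Data.Nat.Properties using (≤-refl; <⇒≤)
open import Data.Product.Base using (_,_)
open import Function.Base using (_∘_)
open import Relation.Binary.Bundles using (Setoid)
open import Relation.Binary.Core using (_Preserves_⟶_)
open import Relation.Binary.PropositionalEquality as ≡ using (_≡_)
import Relation.Binary.Reasoning.Setoid as SetoidReasoning
open import Relation.Nullary using (¬_; Dec; contradiction)
open import Relation.Nullary.Decidable using (¬?)

-- Permutations of duplicate-free lists.

module _ {a ℓ} (S : Setoid a ℓ) where

  open Setoid S
  open Membership S using (_∈_)
  open Permutation S using (_↭_; ↭-refl; ↭-sym; ↭-trans; ↭-prep; ↭-reflexive-≋)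
  open Permutationₚ S using (∈-resp-↭; Unique-resp-↭; shift)

  -- Induction on `xs`: the head `x` occurs in `ys`, is moved to the front there and cancelled;
  -- uniqueness on both sides keeps the membership equivalence for the remainders. This reduces
  -- permutation claims to membership, which for monic polynomials is a condition on coefficients.
  unique-sameElements⇒↭ : ∀ {xs ys} → Unique S xs → Unique S ys →
    (∀ {v} → v ∈ xs → v ∈ ys) → (∀ {v} → v ∈ ys → v ∈ xs) → xs ↭ ys
  unique-sameElements⇒↭ {[]}     {[]}     _ _ _ _ = ↭-refl
  unique-sameElements⇒↭ {[]}     {y ∷ ys} _ _ _ ys⊆[] with () ← ys⊆[] (here refl)
  unique-sameElements⇒↭ {x ∷ xs} {ys} (x# ∷ xs!) ys! ⊆ys ys⊆
    with hs , ts , w , x≈w , ys≋ ← Membershipₚ.∈-∃++ S (⊆ys (here refl)) =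
    ↭-trans (↭-prep x (unique-sameElements⇒↭ xs! zs! xs⊆zs zs⊆xs)) (↭-sym ys↭)
    where
    ys↭ : ys ↭ x ∷ hs ++ ts
    -- The occurrence found in `ys` is some `w` that equals `x` only up to `≈`; `shift` brings it to
    -- the front and replaces it by `x`.
    ys↭ = ↭-trans (↭-reflexive-≋ ys≋) (shift (sym x≈w) hs ts)

    zs! : Unique S (hs ++ ts)
    zs! with _ ∷ u ← Unique-resp-↭ ys↭ ys! = u

    x∉zs : ¬ (x ∈ hs ++ ts)
    x∉zs with u ∷ _ ← Unique-resp-↭ ys↭ ys! = All¬⇒¬Any u

    xs⊆zs : ∀ {v} → v ∈ xs → v ∈ hs ++ ts
    xs⊆zs v∈xs with ∈-resp-↭ ys↭ (⊆ys (there v∈xs))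
    -- Here `x` itself would lie in `xs`, against the uniqueness of `x ∷ xs`.
    ... | here v≈x = contradiction (Membershipₚ.∈-resp-≈ S v≈x v∈xs) (All¬⇒¬Any x#)
    ... | there v∈ = v∈

    zs⊆xs : ∀ {v} → v ∈ hs ++ ts → v ∈ xs
    zs⊆xs v∈zs with ys⊆ (∈-resp-↭ (↭-sym ys↭) (there v∈zs))
    ... | here v≈x = contradiction (Membershipₚ.∈-resp-≈ S v≈x v∈zs) x∉zs
    ... | there v∈ = v∈

-- Reindexing finite sums and products.

module _ {a ℓ m ℓᵐ} (S : Setoid a ℓ) (M : CommutativeMonoid m ℓᵐ) where

  open Setoid S using () renaming (Carrier to I; _≈_ to _≈ₛ_)
  open CommutativeMonoid M
  open Permutation S using (_↭_)

  -- Over the additive and the multiplicative monoid of `B[z]` this is definitionally `∑` and `∏`,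
  -- so each fact below serves both.
  fold : List I → (I → Carrier) → Carrier
  fold xs g = foldr (λ x r → g x ∙ r) ε xs

  fold-cong : ∀ xs {g h} → (∀ x → g x ≈ h x) → fold xs g ≈ fold xs h
  fold-cong []       e = refl
  fold-cong (x ∷ xs) e = ∙-cong (e x) (fold-cong xs e)

  fold-↭ : ∀ {g xs ys} → g Preserves _≈ₛ_ ⟶ _≈_ → xs ↭ ys → fold xs g ≈ fold ys g
  fold-↭ {g} {xs} {ys} pres xs↭ys = begin
    fold xs g              ≡⟨ foldr-map _∙_ g ε xs ⟨
    foldr _∙_ ε (map g xs) ≈⟨ Permutationₚ.foldr-commMonoid setoid isCommutativeMonoid
                                (Permutationₚ.map⁺ S setoid pres xs↭ys) ⟩
    foldr _∙_ ε (map g ys) ≡⟨ foldr-map _∙_ g ε ys ⟩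
    fold ys g              ∎
    where open SetoidReasoning setoid

  -- Change of index along `h`. The lists may differ: for the products, `xs` omits `b` while `ys`
  -- omits the translate of `b`.
  fold-reindex : ∀ {g h xs ys} → g Preserves _≈ₛ_ ⟶ _≈_ → map h xs ↭ ys →
    fold ys g ≈ fold xs (g ∘ h)
  fold-reindex {g} {h} {xs} pres e =
    trans (sym (fold-↭ pres e)) (reflexive (foldr-map (λ x r → g x ∙ r) h ε xs))

-- Substitution as a ring homomorphism.

module Composition {c ℓ} (R : CommutativeRing c ℓ) where

  open Polynomial R
  private
    module R = CommutativeRing R
  open CommutativeRing polynomialRing
  open CommutativeSemigroupProperties *-commutativeSemigroup using (x∙yz≈y∙xz)
  open SetoidReasoning setoid

  const-· : ∀ a p → const a * p ≈ a · p
  const-· a p = trans (+-congˡ {x = a · p} 0∷[]≋[]) (+-identityʳ (a · p))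

  ∘ₚ-const : ∀ a g → const a ∘ₚ g ≈ const a
  ∘ₚ-const a g = trans (+-congˡ {x = const a} (zeroʳ g)) (+-identityʳ (const a))

  ∘ₚ-0∷ : ∀ p g → (R.0# ∷ p) ∘ₚ g ≈ g * (p ∘ₚ g)
  ∘ₚ-0∷ p g = +-congʳ {x = g * (p ∘ₚ g)} 0∷[]≋[]

  ∘ₚ-X : ∀ g → X ∘ₚ g ≈ g
  ∘ₚ-X g = begin
    X ∘ₚ g                ≈⟨ ∘ₚ-0∷ (const R.1#) g ⟩
    g * (const R.1# ∘ₚ g) ≈⟨ *-congˡ {x = g} (∘ₚ-const R.1# g) ⟩
    g * 1#                ≈⟨ *-identityʳ g ⟩
    g                     ∎

  ∘ₚ-+ : ∀ p q g → (p + q) ∘ₚ g ≈ p ∘ₚ g + q ∘ₚ g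
  ∘ₚ-+ []      q       g = refl
  ∘ₚ-+ (a ∷ p) []      g = sym (+-identityʳ ((a ∷ p) ∘ₚ g))
  ∘ₚ-+ (a ∷ p) (b ∷ q) g = begin
    const (a R.+ b) + g * ((p + q) ∘ₚ g)
      ≈⟨ +-congˡ {x = const (a R.+ b)} (*-congˡ {x = g} (∘ₚ-+ p q g)) ⟩
    (const a + const b) + g * (p ∘ₚ g + q ∘ₚ g)
      ≈⟨ +-congˡ {x = const a + const b} (distribˡ g (p ∘ₚ g) (q ∘ₚ g)) ⟩
    (const a + const b) + (g * (p ∘ₚ g) + g * (q ∘ₚ g))
      ≈⟨ +ₚ-interchange (const a) (const b) (g * (p ∘ₚ g)) (g * (q ∘ₚ g)) ⟩
    (a ∷ p) ∘ₚ g + (b ∷ q) ∘ₚ g ∎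

  ∘ₚ-· : ∀ a p g → (a · p) ∘ₚ g ≈ const a * (p ∘ₚ g)
  ∘ₚ-· a []      g = sym (zeroʳ (const a))
  ∘ₚ-· a (b ∷ p) g = begin
    const (a R.* b) + g * ((a · p) ∘ₚ g)
      ≈⟨ +-cong (sym (const-· a (const b))) (*-congˡ {x = g} (∘ₚ-· a p g)) ⟩
    const a * const b + g * (const a * (p ∘ₚ g))
      ≈⟨ +-congˡ {x = const a * const b} (x∙yz≈y∙xz g (const a) (p ∘ₚ g)) ⟩
    const a * const b + const a * (g * (p ∘ₚ g))
      ≈⟨ distribˡ (const a) (const b) (g * (p ∘ₚ g)) ⟨
    const a * ((b ∷ p) ∘ₚ g) ∎

  -- The induction follows the recursion of the product, `(a ∷ p) * q` being `a · q` plus a shift of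
  -- `p * q`: `∘ₚ-·` handles the scalar part, and `∘ₚ-0∷` turns the shift into a factor `g`. With
  -- `∘ₚ-+` and `∘ₚ-const` it lets substitution pass through `∑` and `∏`.
  ∘ₚ-* : ∀ p q g → (p * q) ∘ₚ g ≈ (p ∘ₚ g) * (q ∘ₚ g)
  ∘ₚ-* []      q g = refl
  ∘ₚ-* (a ∷ p) q g = begin
    (a · q + (R.0# ∷ (p * q))) ∘ₚ g
      ≈⟨ ∘ₚ-+ (a · q) (R.0# ∷ (p * q)) g ⟩
    (a · q) ∘ₚ g + (R.0# ∷ (p * q)) ∘ₚ g
      ≈⟨ +-cong (∘ₚ-· a q g) (∘ₚ-0∷ (p * q) g) ⟩
    const a * (q ∘ₚ g) + g * ((p * q) ∘ₚ g)
      ≈⟨ +-congˡ {x = const a * (q ∘ₚ g)} (*-congˡ {x = g} (∘ₚ-* p q g)) ⟩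
    const a * (q ∘ₚ g) + g * ((p ∘ₚ g) * (q ∘ₚ g))
      ≈⟨ +-congˡ {x = const a * (q ∘ₚ g)} (*-assoc g (p ∘ₚ g) (q ∘ₚ g)) ⟨
    const a * (q ∘ₚ g) + (g * (p ∘ₚ g)) * (q ∘ₚ g)
      ≈⟨ distribʳ (q ∘ₚ g) (const a) (g * (p ∘ₚ g)) ⟨
    ((a ∷ p) ∘ₚ g) * (q ∘ₚ g) ∎

-- Translations of the set of monic polynomials of degree `d`.

module Translation {c ℓ q} (𝔽 : FiniteField c ℓ q) where

  open FiniteFieldPolynomials 𝔽
  private
    module F = CommutativeRing (FiniteField.commutativeRing 𝔽)
  open Polynomial (FiniteField.commutativeRing 𝔽)
  open CommutativeRing A
  open AbelianGroupProperties +-abelianGroup using (∙-cancelʳ)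
  open Membership ≋-setoid using (_∈_)
  open Permutation ≋-setoid using (_↭_)

  private
    -0≈0 : F.- F.0# F.≈ F.0#
    -0≈0 = AbelianGroupProperties.ε⁻¹≈ε F.+-abelianGroup

  A[]-neg : ∀ d c → A[ d ] c → A[ d ] (- c)
  A[]-neg d c c< n d≤n = F.trans (coeff-neg c n) (F.trans (F.-‿cong (c< n d≤n)) -0≈0)

  -- The coefficients of `c` vanish from index `d` on, `d` itself included, so neither the leading
  -- coefficient of `p` nor the zeros above it change.
  monic-+ : ∀ d p c → IsMonicOfDegree d p → A[ d ] c → IsMonicOfDegree d (p + c)
  monic-+ d p c (lead , high) c< =
      coeff-+-0 d (c< d ≤-refl) lead
    , λ n d<n → coeff-+-0 n (c< n (<⇒≤ d<n)) (high n d<n)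
    where
    coeff-+-0 : ∀ n {x} → coeff c n F.≈ F.0# → coeff p n F.≈ x → coeff (p + c) n F.≈ x
    coeff-+-0 n c₀ pₓ = F.trans (coeff-+ p c n) (F.trans (F.+-cong pₓ c₀) (F.+-identityʳ _))

  A₊-+ : ∀ d p c → p ∈ A₊ d → A[ d ] c → p + c ∈ A₊ d
  A₊-+ d p c p∈ c< = A₊-complete d (monic-+ d p c (A₊-sound d p∈) c<)

  p≈p-c+c : ∀ p c → p ≈ (p - c) + c
  p≈p-c+c p c = sym (begin
    (p - c) + c   ≈⟨ +-assoc p (- c) c ⟩
    p + (- c + c) ≈⟨ +-congˡ {x = p} (-‿inverseˡ c) ⟩
    p + 0#        ≈⟨ +-identityʳ p ⟩
    p             ∎)
    where open SetoidReasoning setoid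

  translate : Carrier → Carrier → Carrier
  translate c p = p + c

  translate-cong : ∀ c → translate c Preserves _≈_ ⟶ _≈_
  translate-cong c e = +-congʳ {x = c} e

  translate-injective : ∀ c {p q} → translate c p ≈ translate c q → p ≈ q
  translate-injective c {p} {q} = ∙-cancelʳ c p q

  -- Injectivity of translation keeps the image duplicate-free. The preimage of `v` is `v - c`,
  -- again monic of degree `d` because `- c` also lies in `A[ d ]`.
  translate-A₊ : ∀ d {c} → A[ d ] c → map (translate c) (A₊ d) ↭ A₊ d
  translate-A₊ d {c} c< = unique-sameElements⇒↭ ≋-setoid
    (Uniqueₚ.map⁺ ≋-setoid ≋-setoid (translate-injective c) (A₊-unique d))
    (A₊-unique d)
    (λ v∈ → let p , p∈ , v≈ = Membershipₚ.∈-map⁻ ≋-setoid ≋-setoid v∈ in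
      Membershipₚ.∈-resp-≈ ≋-setoid (sym v≈) (A₊-+ d p c p∈ c<))
    (λ {v} v∈ → Membershipₚ.∈-resp-≈ ≋-setoid (sym (p≈p-c+c v c))
      (Membershipₚ.∈-map⁺ ≋-setoid ≋-setoid (translate-cong c) (A₊-+ d v (- c) v∈ (A[]-neg d c c<))))

  private
    ≉? : ∀ b p → Dec (¬ (p ≈ b))
    ≉? b p = ¬? (p ≟ₚ b)

    ≉-resp : ∀ b {p q} → p ≈ q → ¬ (p ≈ b) → ¬ (q ≈ b)
    ≉-resp b p≈q p≉b q≈b = p≉b (trans p≈q q≈b)

  -- By injectivity only `b` is sent to `translate c b`, so deleting a point commutes with
  -- translating.
  translate-A₊∖ : ∀ d {c} b → A[ d ] c → map (translate c) (A₊ d ∖ b) ↭ A₊ d ∖ translate c b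
  translate-A₊∖ d {c} b c< = unique-sameElements⇒↭ ≋-setoid
    (Uniqueₚ.map⁺ ≋-setoid ≋-setoid (translate-injective c)
      (Uniqueₚ.filter⁺ ≋-setoid (≉? b) (A₊-unique d)))
    (Uniqueₚ.filter⁺ ≋-setoid (≉? (translate c b)) (A₊-unique d))
    (λ v∈ → let p , p∈ , v≈ , p≉b = Membershipₚ.∈-map∘filter⁻ ≋-setoid ≋-setoid (≉? b) (≉-resp b) v∈ in
      Membershipₚ.∈-resp-≈ ≋-setoid (sym v≈)
        (Membershipₚ.∈-filter⁺ ≋-setoid (≉? (translate c b)) (≉-resp (translate c b))
          (A₊-+ d p c p∈ c<) (p≉b ∘ translate-injective c)))
    (λ {v} v∈ → let v∈A₊ , v≉ = Membershipₚ.∈-filter⁻ ≋-setoid (≉? (translate c b)) (≉-resp (translate c b)) v∈ in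
      Membershipₚ.∈-map∘filter⁺ ≋-setoid ≋-setoid (≉? b) (≉-resp b) (translate-cong c)
        -- The witness `v - c` differs from `b`, since otherwise `v` would be the deleted point
        -- `b + c`.
        ( v - c , A₊-+ d v (- c) v∈A₊ (A[]-neg d c c<) , p≈p-c+c v c
        , λ e → v≉ (trans (p≈p-c+c v c) (translate-cong c e))))

  -- Both sides filter the same list by equivalent predicates, so they agree as lists, and a product
  -- over them can be rewritten by `≡.cong`.
  ∖-cong : ∀ d {b b′} → b ≈ b′ → A₊ d ∖ b ≡ A₊ d ∖ b′
  ∖-cong d {b} {b′} e = filter-≐ (≉? b) (≉? b′)
    ( (λ a≉b a≈b′ → a≉b (trans a≈b′ (sym e)))
    , (λ a≉b′ a≈b → a≉b′ (trans a≈b e)) ) (A₊ d)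

-- The Carlitz approximation under translation of the variable.

module CarlitzTranslation {c ℓ q} (𝔽 : FiniteField c ℓ q) {b ℓᵇ}
    (B : CommutativeAlgebra (FiniteFieldPolynomials.A 𝔽) b ℓᵇ)
    (f : CommutativeRing.Carrier (FiniteFieldPolynomials.A 𝔽) → CommutativeAlgebra.Carrier B)
    (f-additive : IsAdditive (FiniteFieldPolynomials.A 𝔽) (CommutativeAlgebra.commutativeRing B) f)
    where

  open FiniteFieldPolynomials 𝔽 using (A; A[_]; A₊; A₊_∖_)
  open Carlitz 𝔽 B hiding (_≈_; _+_; _-_; _*_)
  open Translation 𝔽
  private
    module A = CommutativeRing A
    module B = CommutativeAlgebra B
    module f = GroupMorphisms.IsGroupHomomorphism f-additive
    module ι = RingMorphisms.IsRingHomomorphism B.ι-isRingHomomorphism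
  open CommutativeRing B[z]
  open Composition B.commutativeRing
  open Polynomial B.commutativeRing using (∷-cong)
  open AbelianGroupProperties +-abelianGroup using (xyx⁻¹≈y; ⁻¹-∙-comm)
  open SetoidReasoning setoid

  const-cong : ∀ {x y} → x B.≈ y → const x ≈ const y
  const-cong e = ∷-cong e refl

  ∘ₚ-∑ : ∀ as (g : A.Carrier → Carrier) t → ∑ as g ∘ₚ t ≈ ∑ as (λ a → g a ∘ₚ t)
  ∘ₚ-∑ []       g t = refl
  ∘ₚ-∑ (a ∷ as) g t = trans (∘ₚ-+ (g a) (∑ as g) t) (+-congˡ {x = g a ∘ₚ t} (∘ₚ-∑ as g t))

  ∘ₚ-∏ : ∀ as (g : A.Carrier → Carrier) t → ∏ as g ∘ₚ t ≈ ∏ as (λ a → g a ∘ₚ t)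
  ∘ₚ-∏ []       g t = ∘ₚ-const B.1# t
  ∘ₚ-∏ (a ∷ as) g t = trans (∘ₚ-* (g a) (∏ as g) t) (*-congˡ {x = g a ∘ₚ t} (∘ₚ-∏ as g t))

  ∑-cong : ∀ as {g h : A.Carrier → Carrier} → (∀ a → g a ≈ h a) → ∑ as g ≈ ∑ as h
  ∑-cong = fold-cong A.setoid +-commutativeMonoid

  ∏-cong : ∀ as {g h : A.Carrier → Carrier} → (∀ a → g a ≈ h a) → ∏ as g ≈ ∏ as h
  ∏-cong = fold-cong A.setoid *-commutativeMonoid

  ∑-+ : ∀ as (g h : A.Carrier → Carrier) → ∑ as (λ a → g a + h a) ≈ ∑ as g + ∑ as h
  ∑-+ []       g h = refl
  ∑-+ (a ∷ as) g h = trans (+-congˡ {x = g a + h a} (∑-+ as g h))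
    (CommutativeSemigroupProperties.interchange +-commutativeSemigroup (g a) (h a) (∑ as g) (∑ as h))

  ∑-*ʳ : ∀ as (g : A.Carrier → Carrier) k → ∑ as (λ a → g a * k) ≈ ∑ as g * k
  ∑-*ʳ []       g k = refl
  ∑-*ʳ (a ∷ as) g k = trans (+-congˡ {x = g a * k} (∑-*ʳ as g k)) (sym (distribʳ k (g a) (∑ as g)))

  module _ (d : ℕ) {c : A.Carrier} (c< : A[ d ] c) where

    z+c : Carrier
    z+c = X + const (B.ι c)

    linear shifted : A.Carrier → Carrier
    linear  a = X - const (B.ι a)
    shifted a = z+c - const (B.ι a)

    ∘ₚ-linear : ∀ a → linear a ∘ₚ z+c ≈ shifted a
    ∘ₚ-linear a = trans (∘ₚ-+ X (- const (B.ι a)) z+c)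
      -- `- const (B.ι a)` computes to `const (B.- B.ι a)`, hence is itself a constant fixed by
      -- substitution.
      (+-cong (∘ₚ-X z+c) (∘ₚ-const (B.- B.ι a) z+c))

    shifted-cong : ∀ {a a′} → a A.≈ a′ → shifted a ≈ shifted a′
    shifted-cong e = +-congˡ {x = z+c} (-‿cong (const-cong (ι.⟦⟧-cong e)))

    -- Since `B.ι` is additive, the shift of the variable and the shift of the root cancel.
    shifted-translate : ∀ a → shifted (translate c a) ≈ linear a
    shifted-translate a = begin
      (X + C) - const (B.ι (a A.+ c))
        ≈⟨ +-congˡ {x = X + C} (-‿cong (const-cong (ι.+-homo a c))) ⟩
      (X + C) - (const (B.ι a) + C)
        ≈⟨ +-congˡ {x = X + C} (-‿cong (+-comm (const (B.ι a)) C)) ⟩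
      (X + C) - (C + const (B.ι a))
        ≈⟨ +-congˡ {x = X + C} (⁻¹-∙-comm C (const (B.ι a))) ⟨
      (X + C) + (- C + - const (B.ι a))
        ≈⟨ +-assoc (X + C) (- C) (- const (B.ι a)) ⟨
      ((X + C) - C) - const (B.ι a)
        ≈⟨ +-congʳ {x = - const (B.ι a)} (+-assoc X C (- C)) ⟩
      (X + (C - C)) - const (B.ι a)
        ≈⟨ +-congʳ {x = - const (B.ι a)} (+-congˡ {x = X} (-‿inverseʳ C)) ⟩
      (X + 0#) - const (B.ι a)
        ≈⟨ +-congʳ {x = - const (B.ι a)} (+-identityʳ X) ⟩
      X - const (B.ι a) ∎
      where C = const (B.ι c)

    ∏-translate : ∀ b → ∏ (A₊ d ∖ translate c b) shifted ≈ ∏ (A₊ d ∖ b) linear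
    ∏-translate b = trans
      (fold-reindex A.setoid *-commutativeMonoid shifted-cong (translate-A₊∖ d b c<))
      (∏-cong (A₊ d ∖ b) shifted-translate)

    -- The factor `const B.1#` in `unitTerm` is kept so that its sum over `A₊ d` is definitionally
    -- `M d (λ _ → B.1#)`.
    term shiftedTerm unitTerm : A.Carrier → Carrier
    term        b = const (f b) * ∏ (A₊ d ∖ b) linear
    shiftedTerm b = const (f b) * ∏ (A₊ d ∖ b) shifted
    unitTerm    b = const B.1# * ∏ (A₊ d ∖ b) linear

    ∘ₚ-term : ∀ b → term b ∘ₚ z+c ≈ shiftedTerm b
    ∘ₚ-term b = begin
      term b ∘ₚ z+c
        ≈⟨ ∘ₚ-* (const (f b)) (∏ (A₊ d ∖ b) linear) z+c ⟩
      (const (f b) ∘ₚ z+c) * (∏ (A₊ d ∖ b) linear ∘ₚ z+c)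
        ≈⟨ *-cong (∘ₚ-const (f b) z+c)
             (trans (∘ₚ-∏ (A₊ d ∖ b) linear z+c) (∏-cong (A₊ d ∖ b) ∘ₚ-linear)) ⟩
      shiftedTerm b ∎

    -- Reindexing needs this because lists are permuted only up to equality of polynomials. Here `b`
    -- also enters through the range of the product, which `∖-cong` handles.
    shiftedTerm-cong : ∀ {b b′} → b A.≈ b′ → shiftedTerm b ≈ shiftedTerm b′
    shiftedTerm-cong e = *-cong (const-cong (f.⟦⟧-cong e))
      (reflexive (≡.cong (λ as → ∏ as shifted) (∖-cong d e)))

    -- Additivity of `f` splits the coefficient at `b + c`, while `∏-translate` gives both summands
    -- the same product `P`.
    shiftedTerm-translate : ∀ b → shiftedTerm (translate c b) ≈ term b + unitTerm b * const (f c)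
    shiftedTerm-translate b = begin
      const (f (b A.+ c)) * ∏ (A₊ d ∖ translate c b) shifted
        ≈⟨ *-cong (const-cong (f.homo b c)) (∏-translate b) ⟩
      (const (f b) + const (f c)) * P
        ≈⟨ distribʳ P (const (f b)) (const (f c)) ⟩
      term b + const (f c) * P
        ≈⟨ +-congˡ {x = term b} (*-comm (const (f c)) P) ⟩
      term b + P * const (f c)
        ≈⟨ +-congˡ {x = term b} (*-congʳ {x = const (f c)} (*-identityˡ P)) ⟨
      term b + unitTerm b * const (f c) ∎
      where P = ∏ (A₊ d ∖ b) linear

    M-∘ₚ-translate : M d f ∘ₚ z+c ≈ M d f + M d (λ _ → B.1#) * const (f c)
    M-∘ₚ-translate = begin
      M d f ∘ₚ z+c
        ≈⟨ ∘ₚ-∑ (A₊ d) term z+c ⟩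
      ∑ (A₊ d) (λ b → term b ∘ₚ z+c)
        ≈⟨ ∑-cong (A₊ d) ∘ₚ-term ⟩
      ∑ (A₊ d) shiftedTerm
        -- The outer index is replaced by its translate; the inner products are then compared term
        -- by term in `shiftedTerm-translate`.
        ≈⟨ fold-reindex A.setoid +-commutativeMonoid shiftedTerm-cong (translate-A₊ d c<) ⟩
      ∑ (A₊ d) (shiftedTerm ∘ translate c)
        ≈⟨ ∑-cong (A₊ d) shiftedTerm-translate ⟩
      ∑ (A₊ d) (λ b → term b + unitTerm b * const (f c))
        ≈⟨ ∑-+ (A₊ d) term (λ b → unitTerm b * const (f c)) ⟩
      M d f + ∑ (A₊ d) (λ b → unitTerm b * const (f c))
        ≈⟨ +-congˡ {x = M d f} (∑-*ʳ (A₊ d) unitTerm (const (f c))) ⟩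
      M d f + M d (λ _ → B.1#) * const (f c) ∎

    M-difference : M d f ∘ₚ z+c - M d f ≈ M d (λ _ → B.1#) * const (f c)
    M-difference = trans (+-congʳ {x = - M d f} M-∘ₚ-translate)
      (xyx⁻¹≈y (M d f) (M d (λ _ → B.1#) * const (f c)))

theorem4p1p9 : ∀ {a ℓ b ℓᵇ} (q : ℕ) → IsPrimePower q → (𝔽 : FiniteField a ℓ q) →
    let open FiniteFieldPolynomials 𝔽 in
    (B : CommutativeAlgebra A b ℓᵇ) →
    let module B = CommutativeAlgebra B in
    IsIntegralDomain B.commutativeRing →
    (f : CommutativeRing.Carrier A → B.Carrier) → IsAdditive A B.commutativeRing f →
    (d : ℕ) → 1 ≤ d →
    (c : CommutativeRing.Carrier A) → A[ d ] c →
    let open Carlitz 𝔽 B in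
    M d f ∘ₚ (X + const (B.ι c)) - M d f ≈ M d (λ _ → B.1#) * const (f c)
theorem4p1p9 q _ 𝔽 B _ f f-additive d _ c c< =
  CarlitzTranslation.M-difference 𝔽 B f f-additive d c<
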